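{- Let $C\subseteq\omega$ be a co-maximal set. Then there is a computable linear order $\mathcal{L}=(\omega,<_{\mathcal{L}})$ of order type $\omega$ such that the element $[\mathrm{id}]$ does not have an immediate successor in $\Pi_C\mathcal{L}$, where $\mathrm{id}:\omega\to\omega$ is the identity function. Therefore, $\Pi_C\mathcal{L}\ncong\mathbb{N}+\mathbb{Q}\times\mathbb{Z}$.
   Context: $\omega$ denotes the set of natural numbers. $X\subseteq^* Y$ means that $X\setminus Y$ is finite. An infinite set $C\subseteq\omega$ is cohesive if for every c.e. set $W$, either $W\cap C$ or $\overline{W}\cap C$ is finite. A set $M\subseteq\omega$ is maximal if $M$ is c.e. and $\overline{M}$ is cohesive. A set is co-maximal if it is the complement of a maximal set (so co-maximal sets are cohesive). Linear orders are strict. A linear order $\mathcal{L}=(\omega,<_{\mathcal{L}})$ is computable if $<_{\mathcal{L}}$ is a computable relation. It has order type $\omega$ if it is isomorphic to $\mathbb{N}$ with its usual order. Cohesive power: for a cohesive set $C$ and a computable linear order $\mathcal{L}=(\omega,<_{\mathcal{L}})$, let $D$ be the set of partial computable functions $\varphi:\omega\to\omega$ with $C\subseteq^*\mathrm{dom}(\varphi)$. For $\varphi,\psi\in D$ put $\varphi=_C\psi$ iff $C\subseteq^*\{x:\varphi(x){\downarrow}=\psi(x){\downarrow}\}$; $[\varphi]$ denotes the class of $\varphi$. The cohesive power $\Pi_C\mathcal{L}$ has domain $D/{=_C}$, with $[\varphi]<[\psi]$ iff $C\subseteq^*\{x:\varphi(x){\downarrow}<_{\mathcal{L}}\psi(x){\downarrow}\}$.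 An immediate successor of $a$ in a linear order is an element $b>a$ such that no element lies strictly between $a$ and $b$. $\mathbb{N},\mathbb{Z},\mathbb{Q}$ denote the usual ordered sets. $+$ is the sum of linear orders (first summand placed below the second) and $\mathcal{L}_0\times\mathcal{L}_1$ is the lexicographical product, with $\langle k,m\rangle<\langle l,n\rangle$ iff $k<_{\mathcal{L}_0}l$, or $k=l$ and $m<_{\mathcal{L}_1}n$. -}

module Defs where

open import Data.Fin.Base using (Fin)
open import Data.Integer.Base as ℤ using (ℤ)
open import Data.Nat.Base as ℕ using (ℕ; zero; suc; _≤_; _<_)
open import Data.Nat.InfinitelyOften using () renaming (Fin to Finite)
open import Data.Product.Base using (Σ; ∃; ∃-syntax; _×_; _,_; proj₁)
open import Data.Product.Relation.Binary.Lex.Strict using (×-Lex)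
open import Data.Rational.Base as ℚ using (ℚ)
open import Data.Sum.Base using (_⊎_)
open import Data.Sum.Relation.Binary.LeftOrder using (_⊎-<_)
open import Data.Vec.Base using (Vec; []; _∷_; lookup)
open import Function.Bundles using (_⇔_)
open import Level using (Level; 0ℓ)
open import Relation.Binary.Bundles.Raw using (RawRelation)
open import Relation.Binary.Core using (Rel)
open import Relation.Binary.Morphism.Structures using (IsOrderIsomorphism)
open import Relation.Binary.PropositionalEquality.Core using (_≡_; refl)
open import Relation.Binary.Structures using (IsStrictTotalOrder)
open import Relation.Nullary.Negation.Core using (¬_)
open import Relation.Unary using (Pred; _∈_; _∩_; _∖_; ∁; _≐_)

private
  variable
    n : ℕ
    a b ℓ₁ ℓ₂ ℓ₃ ℓ₄ : Level

-- Kleene's μ-recursive functions as the model of computation; `mu f` returns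
-- the least y with f (y ∷ xs) = 0, all smaller arguments giving defined values.

data Code : ℕ → Set where
  zer  : Code n
  succ : Code 1
  proj : Fin n → Code n
  comp : ∀ {m} → Code m → Vec (Code n) m → Code n
  prec : Code n → Code (suc (suc n)) → Code (suc n)
  mu   : Code (suc n) → Code n

infix 4 _[_]⇓_

data _[_]⇓_ : Code n → Vec ℕ n → ℕ → Set where
  zer⇓   : {xs : Vec ℕ n} → zer [ xs ]⇓ 0
  succ⇓  : ∀ {x} → succ [ x ∷ [] ]⇓ suc x
  proj⇓  : {xs : Vec ℕ n} (i : Fin n) → proj i [ xs ]⇓ lookup xs i
  comp⇓  : ∀ {m} {f : Code m} {gs : Vec (Code n) m} {xs ys z} →
           (∀ i → lookup gs i [ xs ]⇓ lookup ys i) →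
           f [ ys ]⇓ z →
           comp f gs [ xs ]⇓ z
  prec-z : ∀ {f : Code n} {g xs y} →
           f [ xs ]⇓ y →
           prec f g [ 0 ∷ xs ]⇓ y
  prec-s : ∀ {f : Code n} {g k xs y z} →
           prec f g [ k ∷ xs ]⇓ y →
           g [ k ∷ y ∷ xs ]⇓ z →
           prec f g [ suc k ∷ xs ]⇓ z
  mu⇓    : ∀ {f : Code (suc n)} {xs y} →
           (∀ i → i < y → ∃[ k ] f [ i ∷ xs ]⇓ suc k) →
           f [ y ∷ xs ]⇓ 0 →
           mu f [ xs ]⇓ y

_⟨_⟩⇓_ : Code 1 → ℕ → ℕ → Set
φ ⟨ x ⟩⇓ y = φ [ x ∷ [] ]⇓ y

dom : Code 1 → Pred ℕ 0ℓ
dom φ x = ∃[ y ] φ ⟨ x ⟩⇓ y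

CE : Pred ℕ 0ℓ → Set
CE W = ∃[ φ ] ∀ x → x ∈ W ⇔ x ∈ dom φ

ComputableRel : Rel ℕ 0ℓ → Set
ComputableRel R = Σ (Code 2) λ χ → ∀ x y →
  (R x y → χ [ x ∷ y ∷ [] ]⇓ 1) × (¬ R x y → χ [ x ∷ y ∷ [] ]⇓ 0)

infix 4 _⊆*_

_⊆*_ : Pred ℕ 0ℓ → Pred ℕ 0ℓ → Set
X ⊆* Y = Finite (X ∖ Y)

-- The positive form of infinitude, classically equivalent to ¬ Finite S
-- (`Inf` of Data.Nat.InfinitelyOften).

Infinite : Pred ℕ 0ℓ → Set
Infinite S = ∀ n → ∃[ x ] n ≤ x × x ∈ S

Cohesive : Pred ℕ 0ℓ → Set₁
Cohesive C = Infinite C ×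
  (∀ (W : Pred ℕ 0ℓ) → CE W → Finite (W ∩ C) ⊎ Finite (∁ W ∩ C))

Maximal : Pred ℕ 0ℓ → Set₁
Maximal M = CE M × Cohesive (∁ M)

CoMaximal : Pred ℕ 0ℓ → Set₁
CoMaximal C = Σ (Pred ℕ 0ℓ) λ M → Maximal M × C ≐ ∁ M

-- `RawRelation` carries a set, its equality _≈_ (a quotient is presented
-- by its representatives) and, as _∼_, the strict order.

infix 4 _≅_

_≅_ : RawRelation a ℓ₁ ℓ₂ → RawRelation b ℓ₃ ℓ₄ → Set _
A ≅ B = ∃ (IsOrderIsomorphism A._≈_ B._≈_ A._∼_ B._∼_)
  where
  module A = RawRelation A
  module B = RawRelation B

module _ (A : RawRelation a ℓ₁ ℓ₂) where
  open RawRelation A renaming (_∼_ to _<ᴬ_)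

  IsImmediateSuccessor : Carrier → Carrier → Set _
  IsImmediateSuccessor x y = x <ᴬ y × ¬ (∃[ z ] x <ᴬ z × z <ᴬ y)

  HasImmediateSuccessor : Carrier → Set _
  HasImmediateSuccessor x = ∃[ y ] IsImmediateSuccessor x y

record ComputableLinearOrder : Set₁ where
  field
    _<ᴸ_               : Rel ℕ 0ℓ
    isStrictTotalOrder : IsStrictTotalOrder _≡_ _<ᴸ_
    computable         : ComputableRel _<ᴸ_

  rawRelation : RawRelation 0ℓ 0ℓ 0ℓ
  rawRelation = record { Carrier = ℕ ; _≈_ = _≡_ ; _∼_ = _<ᴸ_ }

𝐍 𝐙 𝐐 : RawRelation 0ℓ 0ℓ 0ℓ
𝐍 = record { Carrier = ℕ ; _≈_ = _≡_ ; _∼_ = ℕ._<_ }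
𝐙 = record { Carrier = ℤ ; _≈_ = _≡_ ; _∼_ = ℤ._<_ }
𝐐 = record { Carrier = ℚ ; _≈_ = _≡_ ; _∼_ = ℚ._<_ }

HasOrderTypeω : ComputableLinearOrder → Set
HasOrderTypeω L = ComputableLinearOrder.rawRelation L ≅ 𝐍

𝐍+𝐐×𝐙 : RawRelation 0ℓ 0ℓ 0ℓ
𝐍+𝐐×𝐙 = record
  { Carrier = ℕ ⊎ (ℚ × ℤ)
  ; _≈_     = _≡_
  ; _∼_     = 𝐍._∼_ ⊎-< ×-Lex 𝐐._≈_ 𝐐._∼_ 𝐙._∼_
  }
  where
  module 𝐍 = RawRelation 𝐍
  module 𝐐 = RawRelation 𝐐
  module 𝐙 = RawRelation 𝐙

module _ (C : Pred ℕ 0ℓ) where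

  Dom : Set
  Dom = Σ (Code 1) λ φ → C ⊆* dom φ

  -- Elements are programs rather than partial functions; the equality _≈_ below
  -- depends only on the functions they compute.

  Π : ComputableLinearOrder → RawRelation 0ℓ 0ℓ 0ℓ
  Π L = record
    { Carrier = Dom
    ; _≈_ = λ (φ , _) (ψ , _) →
        C ⊆* λ x → ∃[ y ] φ ⟨ x ⟩⇓ y × ψ ⟨ x ⟩⇓ y
    ; _∼_ = λ (φ , _) (ψ , _) →
        C ⊆* λ x → ∃[ y ] ∃[ z ] φ ⟨ x ⟩⇓ y × ψ ⟨ x ⟩⇓ z × y <ᴸ z
    }
    where open ComputableLinearOrder L

  [id] : Dom
  [id] = proj Fin.zero , 0 , λ x _ (_ , x∉dom) → x∉dom (x , proj⇓ Fin.zero)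

{-# OPTIONS --safe #-}
module Submission where

open import Defs
open import Data.Fin.Base using (Fin; zero; suc)
import Data.Integer.Base as ℤ
import Data.Integer.Properties as ℤ
open import Data.Nat.Base hiding (compare; parity)
open import Data.Nat.InfinitelyOften using () renaming (Fin to Finite)
open import Data.Nat.Properties
import Data.Product.Base as Prod
open import Data.Product.Base using (Σ; ∃; ∃-syntax; _×_; _,_; proj₁; proj₂)
import Data.Rational.Properties as ℚ
import Data.Sum.Base as Sum
open import Data.Sum.Base using (_⊎_; inj₁; inj₂; [_,_]′)
open import Data.Sum.Relation.Binary.LeftOrder using (₁∼₁; ₂∼₂)
open import Data.Unit.Base using (⊤; tt)
open import Data.Vec.Base using (Vec; []; _∷_; lookup; tail; tabulate)
open import Data.Vec.Properties using (lookup∘tabulate)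
open import Function.Base using (_∘_; id)
open import Function.Bundles using (mk⇔; module Equivalence)
open import Level using (0ℓ)
open import Relation.Binary.Bundles.Raw using (RawRelation)
open import Relation.Binary.Core using (Rel)
open import Relation.Binary.Definitions using (Reflexive; Transitive; Trichotomous; tri<; tri≈; tri>)
open import Relation.Binary.Morphism.Structures using (IsOrderIsomorphism)
open import Relation.Binary.PropositionalEquality
open import Relation.Binary.Structures using (IsStrictTotalOrder)
open import Relation.Nullary using (Dec; yes; no; ¬_; ¬?; contradiction)
open import Relation.Nullary.Decidable as Dec using (decidable-stable; _×-dec_)
open import Relation.Unary using (Pred; Decidable; _∈_; _∉_; _∩_; ∁; _≐_)

-- Write M for the maximal set. Let r enumerate an infinite computable subset of M
-- in increasing order. Every number y is put into a block: normally block y, but if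
-- y = r ⟨m, x, s⟩ and s is the least stage by which all of [m, x] has entered M,
-- then block m. Blocks are ordered increasingly, and each block decreasingly. Since
-- [m, x] ⊆ M bounds x by the next element of ∁ M, blocks are finite and the order
-- type is ω.
--
-- If [id] < [φ], then φ is dominated on ∁ M by a monotone computable G, because a
-- total function is obtained by waiting for n to enter M or for φ n to halt. Now
-- ∁ M is so sparse that (n, G n] ⊆ M for almost all n in ∁ M, by cohesiveness. For
-- such n some y = r ⟨n + 1, G n, s⟩ lies in block n + 1; as y > G n ≥ φ n, it is
-- placed strictly between n and φ n. The order
-- handles all φ at once through the bounds x, so no universal machine is needed.
--
-- Cohesiveness decides Σ₁ statements, which makes the classical parts of this
-- argument, including the isomorphism with ℕ, constructive.

private
  variable
    m n : ℕ

-- Total computable functions and decidable predicates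

Least : Pred ℕ 0ℓ → Pred ℕ 0ℓ
Least P y = P y × (∀ i → i < y → ¬ P i)

module _ {P : Pred ℕ 0ℓ} (P? : Decidable P) where

  leastBelow : ∀ b → (∃[ y ] Least P y) ⊎ (∀ i → i < b → ¬ P i)
  leastBelow zero    = inj₂ λ _ ()
  leastBelow (suc b) with leastBelow b | P? b
  ... | inj₁ found | _      = inj₁ found
  ... | inj₂ none  | yes Pb = inj₁ (b , Pb , none)
  ... | inj₂ none  | no ¬Pb = inj₂ λ i i<1+b Pi → case-≤ Pi (m<1+n⇒m<n∨m≡n i<1+b)
    where
    case-≤ : ∀ {i} → P i → i < b ⊎ i ≡ b → _
    case-≤ Pi (inj₁ i<b)  = none _ i<b Pi
    case-≤ Pi (inj₂ refl) = ¬Pb Pi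

  least : ∃ P → ∃[ y ] Least P y
  least (y , Py) with leastBelow (suc y)
  ... | inj₁ found = found
  ... | inj₂ none  = contradiction Py (none y ≤-refl)

-- The combinators build a function together with a program for it, in such a way
-- that ⟦_⟧ and Holds unfold to ordinary Agda functions and propositions.

record Fn (n : ℕ) : Set where
  constructor mkFn
  field
    ⟦_⟧   : Vec ℕ n → ℕ
    code  : Code n
    code⇓ : ∀ xs → code [ xs ]⇓ ⟦_⟧ xs

open Fn public

record Sub (m n : ℕ) : Set where
  field
    apply  : Vec ℕ m → Vec ℕ n
    codes  : Vec (Code m) n
    codes⇓ : ∀ xs i → lookup codes i [ xs ]⇓ lookup (apply xs) i

open Sub public

infixr 5 _∷ˢ_
infixl 9 _∘ᶠ_

[]ˢ : Sub m 0
[]ˢ = record { apply = λ _ → [] ; codes = [] ; codes⇓ = λ _ () }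

_∷ˢ_ : Fn m → Sub m n → Sub m (suc n)
f ∷ˢ σ = record
  { apply  = λ xs → ⟦ f ⟧ xs ∷ apply σ xs
  ; codes  = code f ∷ codes σ
  ; codes⇓ = λ { xs zero → code⇓ f xs ; xs (suc i) → codes⇓ σ xs i }
  }

projections : (apply : Vec ℕ m → Vec ℕ n) (ρ : Fin n → Fin m) →
              (∀ xs i → lookup xs (ρ i) ≡ lookup (apply xs) i) → Sub m n
projections f ρ eq = record
  { apply  = f
  ; codes  = tabulate (proj ∘ ρ)
  ; codes⇓ = λ xs i → subst₂ (_[ xs ]⇓_) (sym (lookup∘tabulate (proj ∘ ρ) i)) (eq xs i) (proj⇓ (ρ i))
  }

idˢ : Sub n n
idˢ = projections id id λ _ _ → refl

drop₁ : Sub (suc n) n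
drop₁ = projections tail suc λ { (_ ∷ _) _ → refl }

drop₂ : Sub (suc (suc n)) n
drop₂ = projections (tail ∘ tail) (λ i → suc (suc i)) λ { (_ ∷ _ ∷ _) _ → refl }

drop₃ : Sub (suc (suc (suc n))) n
drop₃ = projections (tail ∘ tail ∘ tail) (λ i → suc (suc (suc i))) λ { (_ ∷ _ ∷ _ ∷ _) _ → refl }

_∘ᶠ_ : Fn n → Sub m n → Fn m
f ∘ᶠ σ = mkFn (⟦ f ⟧ ∘ apply σ) (comp (code f) (codes σ))
  λ xs → comp⇓ (codes⇓ σ xs) (code⇓ f (apply σ xs))

var : Fin n → Fn n
var i = mkFn (λ xs → lookup xs i) (proj i) (λ _ → proj⇓ i)

v₀ : Fn (suc n)
v₀ = var zero

v₁ : Fn (suc (suc n))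
v₁ = var (suc zero)

v₂ : Fn (suc (suc (suc n)))
v₂ = var (suc (suc zero))

v₃ : Fn (suc (suc (suc (suc n))))
v₃ = var (suc (suc (suc zero)))

recursive : (f : Vec ℕ (suc n) → ℕ) (z : Fn n) (s : Fn (suc (suc n))) →
            (∀ xs → ⟦ z ⟧ xs ≡ f (0 ∷ xs)) →
            (∀ k xs → ⟦ s ⟧ (k ∷ f (k ∷ xs) ∷ xs) ≡ f (suc k ∷ xs)) → Fn (suc n)
recursive f z s f0 fs = mkFn f (prec (code z) (code s)) λ { (k ∷ xs) → correct k xs }
  where
  correct : ∀ k xs → prec (code z) (code s) [ k ∷ xs ]⇓ f (k ∷ xs)
  correct zero    xs = subst (_ [ 0 ∷ xs ]⇓_) (f0 xs) (prec-z (code⇓ z xs))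
  correct (suc k) xs = subst (_ [ suc k ∷ xs ]⇓_) (fs k xs) (prec-s (correct k xs) (code⇓ s _))

sucᶠ : Fn n → Fn n
sucᶠ f = mkFn (λ { (x ∷ []) → suc x }) succ (λ { (_ ∷ []) → succ⇓ }) ∘ᶠ (f ∷ˢ []ˢ)

lit : ℕ → Fn n
lit zero    = mkFn (λ _ → 0) zer (λ _ → zer⇓)
lit (suc k) = sucᶠ (lit k)

⟦lit⟧ : ∀ k (xs : Vec ℕ n) → ⟦ lit k ⟧ xs ≡ k
⟦lit⟧ zero    xs = refl
⟦lit⟧ (suc k) xs = cong suc (⟦lit⟧ k xs)

-- For a variable `k` the value of `lit k` equals `k` only by induction; here it is `k` by
-- definition.
const : ℕ → Fn n
const k = mkFn (λ _ → k) (code (lit k)) λ xs → subst (_ [ xs ]⇓_) (⟦lit⟧ k xs) (code⇓ (lit k) xs)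

predᶠ : Fn n → Fn n
predᶠ f = recursive (λ { (x ∷ []) → pred x }) (const 0) v₀ (λ { [] → refl }) (λ { _ [] → refl })
  ∘ᶠ (f ∷ˢ []ˢ)

infixl 6 _+ᶠ_ _∸ᶠ_
infixl 7 _*ᶠ_

_+ᶠ_ _*ᶠ_ _∸ᶠ_ : Fn n → Fn n → Fn n
f +ᶠ g = recursive (λ { (x ∷ y ∷ []) → x + y }) v₀ (sucᶠ v₁)
  (λ { (_ ∷ []) → refl }) (λ { _ (_ ∷ []) → refl }) ∘ᶠ (f ∷ˢ g ∷ˢ []ˢ)
f *ᶠ g = recursive (λ { (x ∷ y ∷ []) → x * y }) (const 0) (v₂ +ᶠ v₁)
  (λ { (_ ∷ []) → refl }) (λ { _ (_ ∷ []) → refl }) ∘ᶠ (f ∷ˢ g ∷ˢ []ˢ)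
-- The recursion runs over the subtrahend, so the arguments are swapped.
f ∸ᶠ g = recursive (λ { (x ∷ y ∷ []) → y ∸ x }) v₀ (predᶠ v₁)
  (λ { (_ ∷ []) → refl }) (λ { k (y ∷ []) → pred[m∸n]≡m∸[1+n] y k }) ∘ᶠ (g ∷ˢ f ∷ˢ []ˢ)

-- Sequences bounded runs, in which 0 means no output: the second result counts only if the first is
-- positive.
guard : ℕ → ℕ → ℕ
guard zero    _ = 0
guard (suc _) x = x

guardᶠ : Fn n → Fn n → Fn n
guardᶠ f g = recursive (λ { (x ∷ y ∷ []) → guard x y }) (const 0) v₂
  (λ { (_ ∷ []) → refl }) (λ { _ (_ ∷ []) → refl }) ∘ᶠ (f ∷ˢ g ∷ˢ []ˢ)

iterate : (ℕ → ℕ) → ℕ → ℕ → ℕ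
iterate f z zero    = z
iterate f z (suc k) = f (iterate f z k)

iterateᶠ : Fn 1 → ℕ → Fn 1
iterateᶠ f z = recursive (λ { (k ∷ []) → iterate (λ x → ⟦ f ⟧ (x ∷ [])) z k }) (const z) (f ∘ᶠ (v₁ ∷ˢ []ˢ))
  (λ { [] → refl }) (λ { _ [] → refl })

∑ : ℕ → (ℕ → ℕ) → ℕ
∑ zero    f = 0
∑ (suc b) f = f b + ∑ b f

∑≡0⇒ : ∀ b f → ∑ b f ≡ 0 → ∀ i → i < b → f i ≡ 0
∑≡0⇒ (suc b) f eq i i<1+b with m<1+n⇒m<n∨m≡n i<1+b
... | inj₁ i<b  = ∑≡0⇒ b f (m+n≡0⇒n≡0 (f b) eq) i i<b
... | inj₂ refl = m+n≡0⇒m≡0 (f b) eq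

∑≡0⇐ : ∀ b f → (∀ i → i < b → f i ≡ 0) → ∑ b f ≡ 0
∑≡0⇐ zero    f all0 = refl
∑≡0⇐ (suc b) f all0 = cong₂ _+_ (all0 b ≤-refl) (∑≡0⇐ b f λ i i<b → all0 i (m<n⇒m<1+n i<b))

∑ᶠ : Fn n → Fn (suc n) → Fn n
∑ᶠ b f = recursive (λ { (k ∷ xs) → ∑ k (λ i → ⟦ f ⟧ (i ∷ xs)) }) (const 0) (f ∘ᶠ (v₀ ∷ˢ drop₂) +ᶠ v₁)
  (λ _ → refl) (λ _ _ → refl) ∘ᶠ (b ∷ˢ idˢ)

-- A test is passed when its value is 0, the convention of mu.

record Pr (n : ℕ) : Set₁ where
  constructor mkPr
  field
    Holds    : Vec ℕ n → Set
    test     : Fn n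
    sound    : ∀ xs → ⟦ test ⟧ xs ≡ 0 → Holds xs
    complete : ∀ xs → Holds xs → ⟦ test ⟧ xs ≡ 0

  holds? : ∀ xs → Dec (Holds xs)
  holds? xs = Dec.map′ (sound xs) (complete xs) (⟦ test ⟧ xs ≟ 0)

open Pr public

infixl 9 _∘ᴾ_
infix 4 _≤ᴾ_ _<ᴾ_ _≡ᴾ_
infixr 3 _∧_
infixr 2 _∨_

_∘ᴾ_ : Pr n → Sub m n → Pr m
P ∘ᴾ σ = mkPr (Holds P ∘ apply σ) (test P ∘ᶠ σ) (sound P ∘ apply σ) (complete P ∘ apply σ)

restate : (P : Pr n) (Q : Vec ℕ n → Set) → (∀ xs → Holds P xs → Q xs) → (∀ xs → Q xs → Holds P xs) → Pr n
restate P Q to from = mkPr Q (test P) (λ xs → to xs ∘ sound P xs) (λ xs → complete P xs ∘ from xs)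

_≤ᴾ_ _<ᴾ_ _≡ᴾ_ : Fn n → Fn n → Pr n
f ≤ᴾ g = mkPr (λ xs → ⟦ f ⟧ xs ≤ ⟦ g ⟧ xs) (f ∸ᶠ g) (λ _ → m∸n≡0⇒m≤n) (λ _ → m≤n⇒m∸n≡0)
f <ᴾ g = restate (sucᶠ f ≤ᴾ g) (λ xs → ⟦ f ⟧ xs < ⟦ g ⟧ xs) (λ _ → id) (λ _ → id)

_∧_ _∨_ : Pr n → Pr n → Pr n
P ∧ Q = mkPr (λ xs → Holds P xs × Holds Q xs) (test P +ᶠ test Q)
  (λ xs eq → sound P xs (m+n≡0⇒m≡0 _ eq) , sound Q xs (m+n≡0⇒n≡0 (⟦ test P ⟧ xs) eq))
  (λ xs (p , q) → cong₂ _+_ (complete P xs p) (complete Q xs q))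
P ∨ Q = mkPr (λ xs → Holds P xs ⊎ Holds Q xs) (test P *ᶠ test Q)
  (λ xs eq → Sum.map (sound P xs) (sound Q xs) (m*n≡0⇒m≡0∨n≡0 _ eq))
  (λ xs → [ (λ p → cong (_* ⟦ test Q ⟧ xs) (complete P xs p))
          , (λ q → trans (cong (⟦ test P ⟧ xs *_) (complete Q xs q)) (*-zeroʳ (⟦ test P ⟧ xs))) ]′)

f ≡ᴾ g = restate (f ≤ᴾ g ∧ g ≤ᴾ f) (λ xs → ⟦ f ⟧ xs ≡ ⟦ g ⟧ xs)
  (λ _ (f≤g , g≤f) → ≤-antisym f≤g g≤f) (λ _ f≡g → ≤-reflexive f≡g , ≤-reflexive (sym f≡g))

not : Pr n → Pr n
not P = mkPr (λ xs → ¬ Holds P xs) (const 1 ∸ᶠ test P)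
  (λ xs eq p → contradiction (trans (cong (1 ∸_) (sym (complete P xs p))) eq) λ ())
  (λ xs ¬p → m≤n⇒m∸n≡0 (n≢0⇒n>0 (¬p ∘ sound P xs)))

all< some< : Fn n → Pr (suc n) → Pr n
all< b P = mkPr (λ xs → ∀ i → i < ⟦ b ⟧ xs → Holds P (i ∷ xs)) (∑ᶠ b (test P))
  (λ xs eq i i<b → sound P _ (∑≡0⇒ (⟦ b ⟧ xs) _ eq i i<b))
  (λ xs all → ∑≡0⇐ (⟦ b ⟧ xs) _ λ i i<b → complete P _ (all i i<b))
some< b P = restate (not (all< b (not P))) (λ xs → ∃[ i ] i < ⟦ b ⟧ xs × Holds P (i ∷ xs))
  (λ xs ¬∀¬ → decidable-stable (anyUpTo? (λ i → holds? P (i ∷ xs)) (⟦ b ⟧ xs))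
    λ ¬∃ → ¬∀¬ λ i i<b p → ¬∃ (i , i<b , p))
  (λ xs (i , i<b , p) ∀¬ → ∀¬ i i<b p)

mu⇓-least : (P : Pr (suc n)) → ∀ xs {y} → Least (λ y → Holds P (y ∷ xs)) y → mu (code (test P)) [ xs ]⇓ y
mu⇓-least P xs {y} (Py , ¬P<y) = mu⇓
  (λ i i<y → pred (⟦ test P ⟧ (i ∷ xs)) ,
    subst (_ [ i ∷ xs ]⇓_)
      (sym (suc-pred _ ⦃ ≢-nonZero (¬P<y i i<y ∘ sound P (i ∷ xs)) ⦄))
      (code⇓ (test P) (i ∷ xs)))
  (subst (_ [ y ∷ xs ]⇓_) (complete P (y ∷ xs) Py) (code⇓ (test P) (y ∷ xs)))

module _ (P : Pr (suc n)) (total : ∀ xs → ∃[ y ] Holds P (y ∷ xs)) where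

  private
    leastHolds : ∀ xs → ∃[ y ] Least (λ y → Holds P (y ∷ xs)) y
    leastHolds xs = least (λ y → holds? P (y ∷ xs)) (total xs)

  opaque

    μ : Fn n
    μ = mkFn (proj₁ ∘ leastHolds) (mu (code (test P))) λ xs → mu⇓-least P xs (proj₂ (leastHolds xs))

    μ-least : ∀ xs → Least (λ y → Holds P (y ∷ xs)) (⟦ μ ⟧ xs)
    μ-least xs = proj₂ (leastHolds xs)

-- Step-bounded evaluation

Eventually : Pred ℕ 0ℓ → Set
Eventually P = ∃[ b ] ∀ s → b ≤ s → P s

always : {P : Pred ℕ 0ℓ} → (∀ s → P s) → Eventually P
always all = 0 , λ s _ → all s

eventually₂ : {P Q R : Pred ℕ 0ℓ} → (∀ {s} → P s → Q s → R s) → Eventually P → Eventually Q → Eventually R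
eventually₂ f (b , P≥b) (c , Q≥c) =
  b ⊔ c , λ s b⊔c≤s → f (P≥b s (m⊔n≤o⇒m≤o b c b⊔c≤s)) (Q≥c s (m⊔n≤o⇒n≤o b c b⊔c≤s))

eventually₁ : {P Q : Pred ℕ 0ℓ} → (∀ {s} → P s → Q s) → Eventually P → Eventually Q
eventually₁ f (b , P≥b) = b , λ s b≤s → f (P≥b s b≤s)

eventually-all< : {P : ℕ → Pred ℕ 0ℓ} → ∀ b → (∀ i → i < b → Eventually (P i)) →
                  Eventually λ s → ∀ i → i < b → P i s
eventually-all< {P} zero    ev = always λ _ _ ()
eventually-all< {P} (suc b) ev =
  eventually₂ extend (ev b ≤-refl) (eventually-all< b λ i i<b → ev i (m<n⇒m<1+n i<b))
  where
  extend : ∀ {s} → P b s → (∀ i → i < b → P i s) → ∀ i → i < suc b → P i s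
  extend Pb P<b i i<1+b with m<1+n⇒m<n∨m≡n i<1+b
  ... | inj₁ i<b  = P<b i i<b
  ... | inj₂ refl = Pb

primrec : Fn n → Fn (suc (suc n)) → Vec ℕ (suc n) → ℕ
primrec z s (zero  ∷ xs) = ⟦ z ⟧ xs
primrec z s (suc k ∷ xs) = ⟦ s ⟧ (k ∷ primrec z s (k ∷ xs) ∷ xs)

primrecᶠ : Fn n → Fn (suc (suc n)) → Fn (suc n)
primrecᶠ z s = recursive (primrec z s) z s (λ _ → refl) (λ _ _ → refl)

-- On y ∷ s ∷ xs, with f a bounded run: the search with fuel s ends at y, as
-- f (y ∷ xs) is undefined or zero, or as the fuel is used up.

stop : Fn (suc (suc n)) → Pr (suc (suc n))
stop f = f ∘ᶠ (v₁ ∷ˢ v₀ ∷ˢ drop₂) ≤ᴾ const 1 ∨ v₀ ≡ᴾ v₁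

stop-total : (f : Fn (suc (suc n))) → ∀ xs → ∃[ y ] Holds (stop f) (y ∷ xs)
stop-total f (s ∷ xs) = s , inj₂ refl

search : Fn (suc (suc n)) → Fn (suc n)
search f = μ (stop f) (stop-total f)

-- On s ∷ xs, the bounded run of c is 0 if it does not halt with fuel s, and
-- suc y if it halts with output y; only the searches consume fuel.

run     : Code n → Fn (suc n)
halting : Vec (Code n) m → Fn (suc n)
outputs : Vec (Code n) m → Sub (suc n) m

-- The counter comes before the fuel because `primrecᶠ` recurses on the first argument.
run-prec : Code n → Code (suc (suc n)) → Fn (suc (suc n))

run zer         = const 1
run succ        = sucᶠ (sucᶠ v₁)
run (proj i)    = sucᶠ (var (suc i))
run (comp f gs) = guardᶠ (halting gs) (run f ∘ᶠ (v₀ ∷ˢ outputs gs))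
run (prec f g)  = run-prec f g ∘ᶠ (v₁ ∷ˢ v₀ ∷ˢ drop₂)
-- The factors vanish for `value` at least 2 and for `value` equal to 0. So the product is positive
-- only if the run of `f` at the search result outputs 0.
run (mu f)      = (const 2 ∸ᶠ value) *ᶠ (value *ᶠ sucᶠ (search (run f)))
  where value = run f ∘ᶠ (v₀ ∷ˢ search (run f) ∷ˢ drop₁)

run-prec f g = primrecᶠ (run f) (guardᶠ v₁ (run g ∘ᶠ (v₂ ∷ˢ v₀ ∷ˢ predᶠ v₁ ∷ˢ drop₃)))

halting []       = const 1
halting (g ∷ gs) = guardᶠ (run g) (halting gs)

outputs []       = []ˢ
-- A run without output yields the default 0; `run` reads it only behind `halting`.
outputs (g ∷ gs) = predᶠ (run g) ∷ˢ outputs gs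

guard≡suc : ∀ x {y z} → guard x y ≡ suc z → x ≡ suc (pred x) × y ≡ suc z
guard≡suc (suc _) eq = refl , eq

guard-suc : ∀ {x w} y → x ≡ suc w → guard x y ≡ y
guard-suc y refl = refl

selects-1 : ∀ v y {z} → (2 ∸ v) * (v * suc y) ≡ suc z → v ≡ 1 × y ≡ z
selects-1 1             y eq = refl , suc-injective (trans (sym (trans (+-identityʳ _) (+-identityʳ _))) eq)
selects-1 (suc (suc v)) y eq = contradiction (trans (sym (cong (_* (suc (suc v) * suc y)) (0∸n≡0 v))) eq) λ ()

run-sound     : (c : Code n) → ∀ s xs {y} → ⟦ run c ⟧ (s ∷ xs) ≡ suc y → c [ xs ]⇓ y
outputs-sound : (gs : Vec (Code n) m) → ∀ s xs {y} → ⟦ halting gs ⟧ (s ∷ xs) ≡ suc y →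
                ∀ i → lookup gs i [ xs ]⇓ lookup (apply (outputs gs) (s ∷ xs)) i
run-prec-sound : (f : Code n) (g : Code (suc (suc n))) → ∀ k s xs {y} →
                 ⟦ run-prec f g ⟧ (k ∷ s ∷ xs) ≡ suc y → prec f g [ k ∷ xs ]⇓ y

run-sound zer         s xs       refl = zer⇓
run-sound succ        s (x ∷ []) refl = succ⇓
run-sound (proj i)    s xs       refl = proj⇓ i
run-sound (comp f gs) s xs       eq   =
  let halts , eq′ = guard≡suc (⟦ halting gs ⟧ (s ∷ xs)) eq in
  comp⇓ (outputs-sound gs s xs halts) (run-sound f s _ eq′)
run-sound (prec f g)  s (k ∷ xs) eq   = run-prec-sound f g k s xs eq
run-sound (mu f)      s xs       eq   =
  let v≡1 , z≡y = selects-1 (⟦ run f ⟧ (s ∷ ⟦ search (run f) ⟧ (s ∷ xs) ∷ xs)) (⟦ search (run f) ⟧ (s ∷ xs)) eq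
      _ , before = μ-least (stop (run f)) (stop-total (run f)) (s ∷ xs)
  in subst (mu f [ xs ]⇓_) z≡y (mu⇓
       -- Before the least stopping point each bounded run is at least 2, that is, it halts with a
       -- positive output.
       (λ i i<z → _ , run-sound f s (i ∷ xs) (≥2⇒suc-suc (≰⇒> (before i i<z ∘ inj₁))))
       (run-sound f s _ v≡1))
  where
  ≥2⇒suc-suc : ∀ {v} → 2 ≤ v → v ≡ suc (suc (v ∸ 2))
  ≥2⇒suc-suc 2≤v = sym (m+[n∸m]≡n 2≤v)

outputs-sound (g ∷ gs) s xs eq zero    = run-sound g s xs (proj₁ (guard≡suc (⟦ run g ⟧ (s ∷ xs)) eq))
outputs-sound (g ∷ gs) s xs eq (suc i) = outputs-sound gs s xs (proj₂ (guard≡suc (⟦ run g ⟧ (s ∷ xs)) eq)) i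

run-prec-sound f g zero    s xs eq = prec-z (run-sound f s xs eq)
run-prec-sound f g (suc k) s xs eq =
  let halts , eq′ = guard≡suc (⟦ run-prec f g ⟧ (k ∷ s ∷ xs)) eq in
  prec-s (run-prec-sound f g k s xs halts) (run-sound g s _ eq′)

-- Asking for all large fuels lets subcomputations share a common fuel without an argument that runs
-- are monotone in the fuel.
run-complete : ∀ {c : Code n} {xs y} → c [ xs ]⇓ y → Eventually λ s → ⟦ run c ⟧ (s ∷ xs) ≡ suc y
outputs-complete : (gs : Vec (Code n) m) → ∀ {xs ys} →
                   (∀ i → Eventually λ s → ⟦ run (lookup gs i) ⟧ (s ∷ xs) ≡ suc (lookup ys i)) →
                   Eventually λ s → ⟦ halting gs ⟧ (s ∷ xs) ≡ 1 × apply (outputs gs) (s ∷ xs) ≡ ys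

run-complete zer⇓       = always λ _ → refl
run-complete succ⇓      = always λ _ → refl
run-complete (proj⇓ i)  = always λ _ → refl
run-complete {xs = xs} (comp⇓ {f = f} {gs = gs} {z = z} gs⇓ f⇓) =
  eventually₂ both (outputs-complete gs λ i → run-complete (gs⇓ i)) (run-complete f⇓)
  where
  both : ∀ {s ys} → ⟦ halting gs ⟧ (s ∷ xs) ≡ 1 × apply (outputs gs) (s ∷ xs) ≡ ys →
         ⟦ run f ⟧ (s ∷ ys) ≡ suc z → ⟦ run (comp f gs) ⟧ (s ∷ xs) ≡ suc z
  both {s} (halts , refl) eq = trans (guard-suc (⟦ run f ⟧ (s ∷ _)) halts) eq
run-complete (prec-z f⇓) = run-complete f⇓
run-complete (prec-s {f = f} {g = g} {xs = xs} {z = z} rec⇓ g⇓) =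
  eventually₂ (λ {s} → both s) (run-complete rec⇓) (run-complete g⇓)
  where
  both : ∀ {k y} s → ⟦ run-prec f g ⟧ (k ∷ s ∷ xs) ≡ suc y → ⟦ run g ⟧ (s ∷ k ∷ y ∷ xs) ≡ suc z →
         ⟦ run-prec f g ⟧ (suc k ∷ s ∷ xs) ≡ suc z
  both {k} s eq₁ eq₂ rewrite eq₁ = eq₂
run-complete (mu⇓ {f = f} {xs = xs} {y = y} before f⇓) =
  eventually₂ (λ {s} (p , q) r → found s p q r)
    (eventually₂ _,_
      (eventually-all< y λ i i<y → eventually₁ ≡2+⇒1< (run-complete (proj₂ (before i i<y))))
      (run-complete f⇓))
    -- With fuel at least `y`, the search is not cut off before it reaches `y`.
    (y , λ _ y≤s → y≤s)
  where
  ≡2+⇒1< : ∀ {v w} → v ≡ suc (suc w) → 1 < v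
  ≡2+⇒1< refl = s≤s (s≤s z≤n)

  found : ∀ s → (∀ i → i < y → 1 < ⟦ run f ⟧ (s ∷ i ∷ xs)) →
          ⟦ run f ⟧ (s ∷ y ∷ xs) ≡ 1 → y ≤ s → ⟦ run (mu f) ⟧ (s ∷ xs) ≡ suc y
  found s below at y≤s =
    trans (cong₂ (λ v z → (2 ∸ v) * (v * suc z)) value≡1 search≡y) (trans (+-identityʳ _) (+-identityʳ _))
    where
    least-stop : Least (λ z → Holds (stop (run f)) (z ∷ s ∷ xs)) (⟦ search (run f) ⟧ (s ∷ xs))
    least-stop = μ-least (stop (run f)) (stop-total (run f)) (s ∷ xs)

    search≡y : ⟦ search (run f) ⟧ (s ∷ xs) ≡ y
    search≡y = ≤-antisym
      (≮⇒≥ λ y<z → proj₂ least-stop y y<z (inj₁ (≤-reflexive at)))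
      (≮⇒≥ λ z<y → [ <⇒≱ (below _ z<y) , (λ z≡s → <⇒≱ z<y (subst (y ≤_) (sym z≡s) y≤s)) ]′ (proj₁ least-stop))

    value≡1 : ⟦ run f ⟧ (s ∷ ⟦ search (run f) ⟧ (s ∷ xs) ∷ xs) ≡ 1
    value≡1 = trans (cong (λ z → ⟦ run f ⟧ (s ∷ z ∷ xs)) search≡y) at

outputs-complete []       {ys = []}     _  = always λ _ → refl , refl
outputs-complete (g ∷ gs) {xs} {y ∷ ys} ev =
  eventually₂ both (ev zero) (outputs-complete gs (ev ∘ suc))
  where
  both : ∀ {s} → ⟦ run g ⟧ (s ∷ xs) ≡ suc y → ⟦ halting gs ⟧ (s ∷ xs) ≡ 1 × apply (outputs gs) (s ∷ xs) ≡ ys →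
         ⟦ halting (g ∷ gs) ⟧ (s ∷ xs) ≡ 1 × apply (outputs (g ∷ gs)) (s ∷ xs) ≡ y ∷ ys
  both {s} eq (halts , eqs) = trans (guard-suc (⟦ halting gs ⟧ (s ∷ xs)) eq) halts , cong₂ _∷_ (cong pred eq) eqs

-- Both outputs are read off the same bounded run, at a fuel large enough for both derivations.
⇓-deterministic : ∀ {c : Code n} {xs y z} → c [ xs ]⇓ y → c [ xs ]⇓ z → y ≡ z
⇓-deterministic c⇓y c⇓z =
  let b , eq = eventually₂ (λ p q → suc-injective (trans (sym p) q)) (run-complete c⇓y) (run-complete c⇓z)
  in eq b ≤-refl

Holds⇒CE : (P : Pr 2) → CE (λ x → ∃[ s ] Holds P (s ∷ x ∷ []))
Holds⇒CE P = mu (code (test P)) , λ x → mk⇔ (to x) (from x)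
  where
  to : ∀ x → ∃[ s ] Holds P (s ∷ x ∷ []) → x ∈ dom (mu (code (test P)))
  to x found = _ , mu⇓-least P (x ∷ []) (proj₂ (least (λ s → holds? P (s ∷ x ∷ [])) found))
  from : ∀ x → x ∈ dom (mu (code (test P))) → ∃[ s ] Holds P (s ∷ x ∷ [])
  from x (s , mu⇓ _ eq) = s , sound P _ (⇓-deterministic (code⇓ (test P) _) eq)

-- Orders with finite initial segments

∑-mono : ∀ b {f g} → (∀ i → i < b → f i ≤ g i) → ∑ b f ≤ ∑ b g
∑-mono zero    f≤g = z≤n
∑-mono (suc b) f≤g = +-mono-≤ (f≤g b ≤-refl) (∑-mono b λ i i<b → f≤g i (m<n⇒m<1+n i<b))

∑-mono-< : ∀ b {f g} → (∀ i → f i ≤ g i) → ∀ {x} → x < b → f x < g x → ∑ b f < ∑ b g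
∑-mono-< (suc b) f≤g x<1+b fx<gx with m<1+n⇒m<n∨m≡n x<1+b
... | inj₁ x<b  = +-mono-≤-< (f≤g b) (∑-mono-< b f≤g x<b fx<gx)
... | inj₂ refl = +-mono-<-≤ fx<gx (∑-mono b λ i _ → f≤g i)

∑-≤-suc : ∀ b x {f g} → (∀ i → i ≢ x → g i ≤ f i) → g x ≤ suc (f x) → ∑ b g ≤ suc (∑ b f)
∑-≤-suc zero    x g≤f gx≤ = z≤n
∑-≤-suc (suc b) x {f} {g} g≤f gx≤ with b ≟ x
... | yes refl = +-mono-≤ gx≤ (∑-mono b λ i i<b → g≤f i (<⇒≢ i<b))
... | no b≢x   = ≤-trans (+-mono-≤ (g≤f b b≢x) (∑-≤-suc b x {f} {g} g≤f gx≤)) (≤-reflexive (+-suc (f b) (∑ b f)))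

∑-cut : ∀ {b c f} → b ≤′ c → (∀ i → b ≤ i → f i ≡ 0) → ∑ c f ≡ ∑ b f
∑-cut ≤′-refl       f≡0 = refl
∑-cut (≤′-step b≤c) f≡0 = cong₂ _+_ (f≡0 _ (≤′⇒≤ b≤c)) (∑-cut b≤c f≡0)

indicator : {A : Set} → Dec A → ℕ
indicator (yes _) = 1
indicator (no  _) = 0

indicator-mono : {A B : Set} (A? : Dec A) (B? : Dec B) → (A → B) → indicator A? ≤ indicator B?
indicator-mono (yes a) (yes b) A⇒B = ≤-refl
indicator-mono (yes a) (no ¬b) A⇒B = contradiction (A⇒B a) ¬b
indicator-mono (no ¬a) B?      A⇒B = z≤n

indicator-no : {A : Set} (A? : Dec A) → ¬ A → indicator A? ≡ 0
indicator-no (yes a) ¬a = contradiction a ¬a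
indicator-no (no  _) _  = refl

indicator-yes : {A : Set} (A? : Dec A) → A → indicator A? ≡ 1
indicator-yes (yes _) _ = refl
indicator-yes (no ¬a) a = contradiction a ¬a

indicator≤1 : {A : Set} (A? : Dec A) → indicator A? ≤ 1
indicator≤1 (yes _) = ≤-refl
indicator≤1 (no  _) = z≤n

module Rank (_≺_ : Rel ℕ 0ℓ) (isStrictTotalOrder : IsStrictTotalOrder _≡_ _≺_)
            (initial : ∀ x → ∃[ b ] ∀ y → y ≺ x → y < b) where

  open IsStrictTotalOrder isStrictTotalOrder
    using (compare) renaming (_<?_ to _≺?_; trans to ≺-trans; irrefl to ≺-irrefl)

  bound : ℕ → ℕ
  bound x = proj₁ (initial x)

  precedes : ℕ → ℕ → ℕ
  precedes x y = indicator (y ≺? x)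

  rank : ℕ → ℕ
  rank x = ∑ (bound x) (precedes x)

  rank-upTo : ∀ x {b} → bound x ≤ b → ∑ b (precedes x) ≡ rank x
  rank-upTo x b≤ = ∑-cut (≤⇒≤′ b≤) λ y b≤y →
    indicator-no (y ≺? x) λ y≺x → <⇒≱ (proj₂ (initial x) y y≺x) b≤y

  -- Over a common bound, `y` counts every predecessor of `x` by transitivity, and `x` itself in
  -- addition.
  rank-mono : ∀ {x y} → x ≺ y → rank x < rank y
  rank-mono {x} {y} x≺y = subst₂ _<_ (rank-upTo x (m≤m⊔n (bound x) (bound y))) (rank-upTo y (m≤n⊔m (bound x) (bound y)))
    (∑-mono-< (bound x ⊔ bound y)
      (λ z → indicator-mono (z ≺? x) (z ≺? y) λ z≺x → ≺-trans z≺x x≺y)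
      (<-≤-trans (proj₂ (initial y) x x≺y) (m≤n⊔m (bound x) (bound y)))
      (subst₂ _<_ (sym (indicator-no (x ≺? x) (≺-irrefl refl))) (sym (indicator-yes (x ≺? y) x≺y)) ≤-refl))

  rank-cancel : ∀ {x y} → rank x < rank y → x ≺ y
  rank-cancel {x} {y} r<r with compare x y
  ... | tri< x≺y _ _  = x≺y
  ... | tri≈ _ refl _ = contradiction r<r (<-irrefl refl)
  ... | tri> _ _ y≺x  = contradiction r<r (<-asym (rank-mono y≺x))

  rank-injective : ∀ {x y} → rank x ≡ rank y → x ≡ y
  rank-injective {x} {y} r≡r with compare x y
  ... | tri< x≺y _ _ = contradiction r≡r (<⇒≢ (rank-mono x≺y))
  ... | tri≈ _ x≡y _ = x≡y
  ... | tri> _ _ y≺x = contradiction (sym r≡r) (<⇒≢ (rank-mono y≺x))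

  module _ {P : Pred ℕ 0ℓ} (P? : Decidable P) where

    minimal : ∃ P → ∃[ y ] P y × (∀ z → z ≺ y → ¬ P z)
    minimal (y , Py) = descend (suc (rank y)) y ≤-refl Py
      where
      descend : ∀ fuel y → rank y < fuel → P y → ∃[ y ] P y × (∀ z → z ≺ y → ¬ P z)
      descend (suc fuel) y (s≤s r≤fuel) Py with anyUpTo? (λ z → (z ≺? y) ×-dec P? z) (bound y)
      ... | yes (z , _ , z≺y , Pz) = descend fuel z (<-≤-trans (rank-mono z≺y) r≤fuel) Pz
      ... | no none = y , Py , λ z z≺y Pz → none (z , proj₂ (initial y) z z≺y , z≺y , Pz)

  above : ∀ x → ∃[ y ] x ≺ y
  -- This number differs from `x` and is too large to precede it.
  above x with compare x (suc x ⊔ bound x)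
  ... | tri< x≺y _ _ = _ , x≺y
  ... | tri≈ _ x≡y _ = contradiction x≡y (<⇒≢ (m≤m⊔n (suc x) (bound x)))
  ... | tri> _ _ y≺x = contradiction (m≤n⊔m (suc x) (bound x)) (<⇒≱ (proj₂ (initial x) _ y≺x))

  -- By induction: the least element above the one of rank `j` has exactly one more predecessor.
  rank-surjective : ∀ j → ∃[ x ] rank x ≡ j
  rank-surjective zero =
    let x , _ , first = minimal {P = λ _ → ⊤} (λ _ → yes tt) (0 , tt) in
    x , ∑≡0⇐ (bound x) (precedes x) λ z _ → indicator-no (z ≺? x) λ z≺x → first z z≺x tt
  rank-surjective (suc j) =
    let x , rank≡j = rank-surjective j
        y , x≺y , next = minimal (x ≺?_) (above x)
    in y , trans (≤-antisym (rank≤ x y next) (rank-mono x≺y)) (cong suc rank≡j)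
    where
    rank≤ : ∀ x y → (∀ z → z ≺ y → ¬ x ≺ z) → rank y ≤ suc (rank x)
    rank≤ x y next = subst₂ _≤_ (rank-upTo y (m≤n⊔m (bound x) _)) (cong suc (rank-upTo x (m≤m⊔n _ (bound y))))
      (∑-≤-suc (bound x ⊔ bound y) x
        (λ z z≢x → indicator-mono (z ≺? y) (z ≺? x) λ z≺y → precedes-x z z≢x z≺y)
        (≤-trans (indicator≤1 (x ≺? y)) (s≤s z≤n)))
      where
      precedes-x : ∀ z → z ≢ x → z ≺ y → z ≺ x
      precedes-x z z≢x z≺y with compare z x
      ... | tri< z≺x _ _ = z≺x
      ... | tri≈ _ z≡x _ = contradiction z≡x z≢x
      ... | tri> _ _ x≺z = contradiction x≺z (next z z≺y)

  rank-isOrderIsomorphism : IsOrderIsomorphism _≡_ _≡_ _≺_ _<_ rank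
  rank-isOrderIsomorphism = record
    { isOrderMonomorphism = record
      { isOrderHomomorphism = record { cong = cong rank ; mono = rank-mono }
      ; injective           = rank-injective
      ; cancel              = rank-cancel
      }
    ; surjective = λ j → let x , rank≡j = rank-surjective j in x , λ { refl → rank≡j }
    }

-- Immediate successors in ℕ + ℚ × ℤ

<⇒≮suc : ∀ {i j} → i ℤ.< j → ¬ j ℤ.< ℤ.suc i
<⇒≮suc i<j j<1+i = ℤ.<-irrefl refl (ℤ.<-≤-trans j<1+i (ℤ.i<j⇒suc[i]≤j i<j))

𝐍+𝐐×𝐙-hasImmediateSuccessor : ∀ x → HasImmediateSuccessor 𝐍+𝐐×𝐙 x
𝐍+𝐐×𝐙-hasImmediateSuccessor (inj₁ n) = inj₁ (suc n) , ₁∼₁ ≤-refl , λ where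
  (inj₁ z , ₁∼₁ n<z , ₁∼₁ z<1+n) → <⇒≱ n<z (s≤s⁻¹ z<1+n)
𝐍+𝐐×𝐙-hasImmediateSuccessor (inj₂ (q , i)) =
  inj₂ (q , ℤ.suc i) , ₂∼₂ (inj₂ (refl , ℤ.suc[i]≤j⇒i<j ℤ.≤-refl)) , λ where
    (inj₂ (p , j) , ₂∼₂ (inj₁ q<p)          , ₂∼₂ (inj₁ p<q))             → ℚ.<-asym q<p p<q
    (inj₂ (p , j) , ₂∼₂ (inj₁ q<p)          , ₂∼₂ (inj₂ (refl , _)))      → ℚ.<-irrefl refl q<p
    (inj₂ (p , j) , ₂∼₂ (inj₂ (refl , _))   , ₂∼₂ (inj₁ p<q))             → ℚ.<-irrefl refl p<q
    (inj₂ (p , j) , ₂∼₂ (inj₂ (refl , i<j)) , ₂∼₂ (inj₂ (refl , j<1+i))) → <⇒≮suc i<j j<1+i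

-- A preimage of the successor of `f x` works, as anything in between would be mapped in between.
-- Reflexivity turns the setoid form of surjectivity into an equation.
≅𝐍+𝐐×𝐙⇒hasImmediateSuccessor : ∀ {a ℓ₁ ℓ₂} (A : RawRelation a ℓ₁ ℓ₂) → Reflexive (RawRelation._≈_ A) →
                               A ≅ 𝐍+𝐐×𝐙 → ∀ x → HasImmediateSuccessor A x
≅𝐍+𝐐×𝐙⇒hasImmediateSuccessor A ≈-refl (f , iso) x =
  let y , fx<y , gap = 𝐍+𝐐×𝐙-hasImmediateSuccessor (f x)
      x′ , f≈y       = surjective y
      fx′≡y          = f≈y ≈-refl
  in x′ , cancel (subst (f x <ᴮ_) (sym fx′≡y) fx<y) ,
     λ (z , x<z , z<x′) → gap (f z , mono x<z , subst (f z <ᴮ_) fx′≡y (mono z<x′))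
  where
  open IsOrderIsomorphism iso
  open RawRelation 𝐍+𝐐×𝐙 using () renaming (_∼_ to _<ᴮ_)

-- The linear order

-- The value lies between the square of `a + b` and the next square, so it determines `a + b` and
-- then `a`; no division by 2 is involved.
pair : ℕ → ℕ → ℕ
pair a b = (a + b) * (a + b) + a

pair-mono : ∀ a b c d → a + b < c + d → pair a b < pair c d
pair-mono a b c d s<t = begin-strict
  (a + b) * (a + b) + a                     <⟨ +-monoʳ-< ((a + b) * (a + b)) (s≤s (m≤m+n a b)) ⟩
  (a + b) * (a + b) + suc (a + b)           ≤⟨ +-monoˡ-≤ (suc (a + b)) (*-monoʳ-≤ (a + b) (n≤1+n (a + b))) ⟩
  (a + b) * suc (a + b) + suc (a + b)       ≡⟨ +-comm _ (suc (a + b)) ⟩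
  suc (a + b) * suc (a + b)                 ≤⟨ *-mono-≤ s<t s<t ⟩
  (c + d) * (c + d)                         ≤⟨ m≤m+n _ c ⟩
  (c + d) * (c + d) + c                     ∎
  where open ≤-Reasoning

pair-injective : ∀ {a b c d} → pair a b ≡ pair c d → a ≡ c × b ≡ d
pair-injective {a} {b} {c} {d} eq with <-cmp (a + b) (c + d)
... | tri< s<t _ _ = contradiction eq (<⇒≢ (pair-mono a b c d s<t))
... | tri> _ _ t<s = contradiction (sym eq) (<⇒≢ (pair-mono c d a b t<s))
... | tri≈ _ s≡t _ = a≡c , +-cancelˡ-≡ a b d (trans s≡t (cong (_+ d) (sym a≡c)))
  where
  a≡c : a ≡ c
  a≡c = +-cancelˡ-≡ ((a + b) * (a + b)) a c (trans eq (cong (λ s → s * s + c) (sym s≡t)))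

n≤n*n : ∀ n → n ≤ n * n
n≤n*n zero    = z≤n
n≤n*n (suc n) = m≤m*n (suc n) (suc n)

≤-pairˡ : ∀ a b → a ≤ pair a b
≤-pairˡ a b = m≤n+m a _

≤-pairʳ : ∀ a b → b ≤ pair a b
≤-pairʳ a b = ≤-trans (m≤n+m b a) (≤-trans (n≤n*n (a + b)) (m≤m+n _ a))

triple : ℕ → ℕ → ℕ → ℕ
triple m x s = pair (pair m x) s

tripleᶠ : ∀ {n} → Fn n → Fn n → Fn n → Fn n
tripleᶠ f g h = pairᶠ (pairᶠ f g) h
  where
  pairᶠ : Fn _ → Fn _ → Fn _
  pairᶠ f g = (f +ᶠ g) *ᶠ (f +ᶠ g) +ᶠ f

-- This is f 0 + ... + f k + (k + 1), hence monotone and above both `f` and the identity.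
majorant : (f : ℕ → ℕ) → ℕ → ℕ
majorant f zero    = suc (f 0)
majorant f (suc k) = suc (majorant f k + f (suc k))

majorantᶠ : Fn 1 → Fn 1
majorantᶠ f = recursive (λ { (k ∷ []) → majorant (λ n → ⟦ f ⟧ (n ∷ [])) k })
  (sucᶠ (f ∘ᶠ (const 0 ∷ˢ []ˢ))) (sucᶠ (v₁ +ᶠ f ∘ᶠ (sucᶠ v₀ ∷ˢ []ˢ)))
  (λ { [] → refl }) (λ { _ [] → refl })

f≤majorant : ∀ f k → f k ≤ majorant f k
f≤majorant f zero    = n≤1+n _
f≤majorant f (suc k) = m≤n⇒m≤1+n (m≤n+m _ (majorant f k))

k<majorant : ∀ f k → k < majorant f k
k<majorant f zero    = s≤s z≤n
k<majorant f (suc k) = s≤s (≤-trans (k<majorant f k) (m≤m+n _ _))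

step⇒mono : ∀ {f : ℕ → ℕ} → (∀ k → f k ≤ f (suc k)) → ∀ {j k} → j ≤ k → f j ≤ f k
step⇒mono {f} step j≤k = go (≤⇒≤′ j≤k)
  where
  go : ∀ {j k} → j ≤′ k → f j ≤ f k
  go ≤′-refl       = ≤-refl
  go (≤′-step j≤k) = ≤-trans (go j≤k) (step _)

majorant-mono : ∀ f {j k} → j ≤ k → majorant f j ≤ majorant f k
majorant-mono f = step⇒mono λ k → m≤n⇒m≤1+n (m≤m+n _ _)

Holds⇒ComputableRel : (P : Pr 2) → ComputableRel λ x y → Holds P (x ∷ y ∷ [])
Holds⇒ComputableRel P = code χ , λ x y →
  (λ p → subst (code χ [ x ∷ y ∷ [] ]⇓_) (cong (1 ∸_) (complete P _ p)) (code⇓ χ _)) ,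
  (λ ¬p → subst (code χ [ x ∷ y ∷ [] ]⇓_) (m≤n⇒m∸n≡0 (n≢0⇒n>0 (¬p ∘ sound P _))) (code⇓ χ _))
  where
  χ : Fn 2
  χ = const 1 ∸ᶠ test P

module Construction (M : Pred ℕ 0ℓ) (M-ce : CE M) (∁M-cohesive : Cohesive (∁ M)) where

  -- Consequences of cohesiveness: Σ₁ decisions and the sparseness of ∁ M

  φ : Code 1
  φ = proj₁ M-ce

  infinite : Infinite (∁ M)
  infinite = proj₁ ∁M-cohesive

  -- A Σ₁ statement ∃ t P t is decided by the c.e. set { x ∣ P t for some t ≤ x },
  -- which is empty or cofinite.
  lpo : (P : Pr 1) → (∃[ t ] Holds P (t ∷ [])) ⊎ (∀ t → ¬ Holds P (t ∷ []))
  lpo P = [ inj₂ ∘ never , inj₁ ∘ halts ]′ (proj₂ ∁M-cohesive _ (Holds⇒CE (W ∘ᴾ (v₁ ∷ˢ []ˢ))))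
    where
    W : Pr 1
    W = some< (sucᶠ v₀) (P ∘ᴾ (v₀ ∷ˢ []ˢ))

    W₁ : Pred ℕ 0ℓ
    W₁ x = ∃[ s ] Holds (W ∘ᴾ (v₁ ∷ˢ []ˢ)) (s ∷ x ∷ [])

    never : Finite (W₁ ∩ ∁ M) → ∀ t → ¬ Holds P (t ∷ [])
    never (i , W∩C) t Pt =
      let x , i⊔t≤x , x∉M = infinite (i ⊔ t) in
      W∩C x (m⊔n≤o⇒m≤o i t i⊔t≤x) ((0 , t , s≤s (m⊔n≤o⇒n≤o i t i⊔t≤x) , Pt) , x∉M)

    halts : Finite (∁ W₁ ∩ ∁ M) → ∃[ t ] Holds P (t ∷ [])
    halts (i , ∁W∩C) =
      let x , i≤x , x∉M = infinite i
          t , _ , Pt    = decidable-stable (anyUpTo? (λ t → holds? P (t ∷ [])) (suc x))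
                            λ none → ∁W∩C x i≤x ((λ (_ , w) → none w) , x∉M)
      in t , Pt

  entered : Pr 2
  entered = const 1 ≤ᴾ run φ

  entered⇒∈M : ∀ {s x} → Holds entered (s ∷ x ∷ []) → x ∈ M
  entered⇒∈M {s} {x} 1≤run = Equivalence.from (proj₂ M-ce x)
    (_ , run-sound φ s (x ∷ []) (sym (suc-pred _ ⦃ >-nonZero 1≤run ⦄)))

  ∈M⇒entered : ∀ {x} → x ∈ M → Eventually λ s → Holds entered (s ∷ x ∷ [])
  ∈M⇒entered {x} x∈M = eventually₁ (λ eq → subst (1 ≤_) (sym eq) (s≤s z≤n))
    (run-complete (proj₂ (Equivalence.to (proj₂ M-ce x) x∈M)))

  -- Membership in a c.e. set is a Σ₁ statement, so `lpo` decides it. This is a constructive case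
  -- distinction and provides no `Code` for M.
  ∈M? : Decidable M
  ∈M? x = [ (λ (_ , e) → yes (entered⇒∈M e))
          , (λ never → no λ x∈M → let b , e = ∈M⇒entered x∈M in never b (e b ≤-refl))
          ]′ (lpo (entered ∘ᴾ (v₀ ∷ˢ const x ∷ˢ []ˢ)))

  -- Otherwise ∁ M meets almost all intervals of a computable partition of ω into
  -- intervals, so the union of every other interval splits ∁ M.
  gaps : (G : Fn 1) → let g = λ b → ⟦ G ⟧ (b ∷ []) in (∀ b → b < g b) →
         ∀ b₀ → ¬ (∀ b → b₀ ≤ b → ∃[ c ] b < c × c ≤ g b × c ∉ M)
  gaps G b<g b₀ meets = split (proj₂ ∁M-cohesive _ (Holds⇒CE (even-index ∘ᴾ (v₁ ∷ˢ []ˢ))))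
    where
    g : ℕ → ℕ
    g b = ⟦ G ⟧ (b ∷ [])

    a : ℕ → ℕ
    a = iterate g 0

    k≤a : ∀ k → k ≤ a k
    k≤a zero    = z≤n
    k≤a (suc k) = ≤-<-trans (k≤a k) (b<g (a k))

    a-mono : ∀ {j k} → j ≤ k → a j ≤ a k
    a-mono = step⇒mono λ k → <⇒≤ (b<g (a k))

    below : Pr 2
    below = v₁ ≤ᴾ iterateᶠ G 0 ∘ᶠ (v₀ ∷ˢ []ˢ)

    below-total : ∀ xs → ∃[ k ] Holds below (k ∷ xs)
    below-total (x ∷ []) = x , k≤a x

    index : Fn 1
    index = μ below below-total

    index≡ : ∀ {k x} → a k < x → x ≤ a (suc k) → ⟦ index ⟧ (x ∷ []) ≡ suc k
    index≡ {k} {x} a<x x≤a with μ-least below below-total (x ∷ [])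
    ... | at , before = ≤-antisym (≮⇒≥ λ k<i → before (suc k) k<i x≤a)
                                  (≰⇒> λ i≤k → <⇒≱ a<x (≤-trans at (a-mono i≤k)))

    parity : ℕ → ℕ
    parity = iterate (1 ∸_) 0

    parityᶠ : Fn 1
    parityᶠ = iterateᶠ (const 1 ∸ᶠ v₀) 0

    even-index : Pr 1
    even-index = parityᶠ ∘ᶠ (index ∷ˢ []ˢ) ≡ᴾ const 0

    member : ∀ i k → i ⊔ b₀ ≤ k → ∃[ c ] i ≤ c × c ∉ M × ⟦ index ⟧ (c ∷ []) ≡ suc k
    member i k i⊔b₀≤k =
      let c , a<c , c≤a , c∉M = meets (a k) (≤-trans (m⊔n≤o⇒n≤o i b₀ i⊔b₀≤k) (k≤a k))
      in c , ≤-trans (m⊔n≤o⇒m≤o i b₀ i⊔b₀≤k) (≤-trans (k≤a k) (<⇒≤ a<c)) , c∉M , index≡ a<c c≤a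

    1∸-≢0 : ∀ {p} → p ≢ 0 → 1 ∸ p ≡ 0
    1∸-≢0 {zero}  p≢0 = contradiction refl p≢0
    1∸-≢0 {suc p} _   = 0∸n≡0 p

    even-member : ∀ i → ∃[ c ] i ≤ c × c ∉ M × Holds even-index (c ∷ [])
    even-member i with parity (suc (i ⊔ b₀)) ≟ 0
    ... | yes even = let c , i≤c , c∉M , eq = member i _ ≤-refl in
      c , i≤c , c∉M , trans (cong parity eq) even
    -- Consecutive intervals have opposite parity, so the next one is even.
    ... | no odd = let c , i≤c , c∉M , eq = member i _ (n≤1+n (i ⊔ b₀)) in
      c , i≤c , c∉M , trans (cong parity eq) (1∸-≢0 odd)

    odd-member : ∀ i → ∃[ c ] i ≤ c × c ∉ M × ¬ Holds even-index (c ∷ [])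
    odd-member i with parity (suc (i ⊔ b₀)) ≟ 0
    ... | no odd = let c , i≤c , c∉M , eq = member i _ ≤-refl in
      c , i≤c , c∉M , λ even → odd (trans (sym (cong parity eq)) even)
    ... | yes even = let c , i≤c , c∉M , eq = member i _ (n≤1+n (i ⊔ b₀)) in
      c , i≤c , c∉M , λ even′ → contradiction
        (trans (sym (trans (cong parity eq) (cong (1 ∸_) even))) even′) λ ()

    split : Finite _ ⊎ Finite _ → _
    split (inj₁ (i , none)) = let c , i≤c , c∉M , even = even-member i in none c i≤c ((0 , even) , c∉M)
    split (inj₂ (i , none)) = let c , i≤c , c∉M , odd = odd-member i in none c i≤c ((λ (_ , even) → odd even) , c∉M)

  -- s ∷ m ∷ x: every element of [m, x] is in M by stage s.
  covered : Pr 3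
  covered = all< (sucᶠ v₂) (v₀ <ᴾ v₂ ∨ entered ∘ᴾ (v₁ ∷ˢ v₀ ∷ˢ []ˢ))

  covered-eventually : ∀ m x → (∀ z → m ≤ z → z ≤ x → z ∈ M) → Eventually λ s → Holds covered (s ∷ m ∷ x ∷ [])
  covered-eventually m x ⊆M = eventually-all< (suc x) λ z z<1+x →
    [ (λ z<m → always λ _ → inj₁ z<m)
    , (λ m≤z → eventually₁ inj₂ (∈M⇒entered (⊆M z m≤z (s≤s⁻¹ z<1+x))))
    ]′ (<-≤-connex z m)

  covered⇒∈M : ∀ {s m x z} → Holds covered (s ∷ m ∷ x ∷ []) → m ≤ z → z ≤ x → z ∈ M
  covered⇒∈M cov m≤z z≤x = [ (λ z<m → contradiction m≤z (<⇒≱ z<m)) , entered⇒∈M ]′ (cov _ (s≤s z≤x))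

  -- Markov's principle for this Σ₁ statement, obtained from `lpo`.
  covered-stable : ∀ m x → ¬ ¬ (∃[ s ] Holds covered (s ∷ m ∷ x ∷ [])) → ∃[ s ] Holds covered (s ∷ m ∷ x ∷ [])
  covered-stable m x ¬¬cov = [ id , (λ never → contradiction (λ (s , cov) → never s cov) ¬¬cov) ]′
    (lpo (covered ∘ᴾ (v₀ ∷ˢ const m ∷ˢ const x ∷ˢ []ˢ)))

  -- If almost every n in ∁ M had another element of ∁ M in (n, g n], iterating from
  -- one such n would bound all gaps of ∁ M by g.
  sparse : (G : Fn 1) → let g = λ b → ⟦ G ⟧ (b ∷ []) in
           (∀ b → b < g b) → (∀ {b c} → b ≤ c → g b ≤ g c) →
           Eventually λ n → n ∉ M → ∃[ s ] Holds covered (s ∷ suc n ∷ g n ∷ [])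
  sparse G b<g g-mono = [ never-covered , covered-later ]′ (proj₂ ∁M-cohesive _ (Holds⇒CE W))
    where
    g : ℕ → ℕ
    g b = ⟦ G ⟧ (b ∷ [])

    W : Pr 2
    W = covered ∘ᴾ (v₀ ∷ˢ sucᶠ v₁ ∷ˢ G ∘ᶠ (v₁ ∷ˢ []ˢ) ∷ˢ []ˢ)

    Covered : Pred ℕ 0ℓ
    Covered n = ∃[ s ] Holds covered (s ∷ suc n ∷ g n ∷ [])

    covered-later : Finite (∁ Covered ∩ ∁ M) → Eventually λ n → n ∉ M → Covered n
    covered-later (i , none) = i , λ n i≤n n∉M →
      covered-stable (suc n) (g n) λ ¬cov → none n i≤n (¬cov , n∉M)

    module _ (i : ℕ) (none : ∀ n → i ≤ n → ¬ (Covered n × n ∉ M)) where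

      Next : ℕ → Pred ℕ 0ℓ
      Next b c = b < c × c ∉ M

      -- If the interval (n, g n] missed ∁ M, it would be covered at some stage, against `none`.
      next : ∀ n → i ≤ n → n ∉ M → ∃[ c ] c < suc (g n) × Next n c
      next n i≤n n∉M = decidable-stable (anyUpTo? (λ c → (n <? c) ×-dec ¬? (∈M? c)) (suc (g n))) λ none-in →
        let b , cov = covered-eventually (suc n) (g n) λ z n<z z≤g →
              decidable-stable (∈M? z) λ z∉M → none-in (z , s≤s z≤g , n<z , z∉M)
        in none n i≤n ((b , cov b ≤-refl) , n∉M)

      -- The invariant of the iteration: `b` lies in a gap of ∁ M that is bounded by `g c` for some
      -- earlier `c` in ∁ M.
      Between : Pred ℕ 0ℓ
      Between b = ∃[ c ] i ≤ c × c ≤ b × c ∉ M × ∃[ d ] d < suc (g c) × Next b d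

      -- While `d` is beyond `suc b` nothing changes; once it equals `suc b`, it takes over the role
      -- of `c`.
      advance : ∀ {b} → Between b → Between (suc b)
      advance (c , i≤c , c≤b , c∉M , d , d≤g , b<d , d∉M) with m≤n⇒m<n∨m≡n b<d
      ... | inj₁ 1+b<d = c , i≤c , m≤n⇒m≤1+n c≤b , c∉M , d , d≤g , 1+b<d , d∉M
      ... | inj₂ refl  = d , i≤d , ≤-refl , d∉M , next d i≤d d∉M
        where
        i≤d : i ≤ d
        i≤d = ≤-trans i≤c (m≤n⇒m≤1+n c≤b)

      between : ∀ {c₀} → i ≤ c₀ → c₀ ∉ M → ∀ {b} → c₀ ≤′ b → Between b
      between {c₀} i≤c₀ c₀∉M ≤′-refl        = c₀ , i≤c₀ , ≤-refl , c₀∉M , next c₀ i≤c₀ c₀∉M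
      between {c₀} i≤c₀ c₀∉M (≤′-step c₀≤b) = advance (between i≤c₀ c₀∉M c₀≤b)

    never-covered : Finite (Covered ∩ ∁ M) → Eventually λ n → n ∉ M → Covered n
    never-covered (i , none) =
      let c₀ , i≤c₀ , c₀∉M = infinite i in
      contradiction (λ b c₀≤b →
        let c , _ , c≤b , _ , d , d<1+g , b<d , d∉M = between i none i≤c₀ c₀∉M (≤⇒≤′ c₀≤b)
        -- Monotonicity replaces the bound `g c` by `g b`, which `gaps` requires.
        in d , b<d , ≤-trans (s≤s⁻¹ d<1+g) (g-mono c≤b) , d∉M)
      (gaps G b<g c₀)

  -- An increasing computable sequence in M

  -- The dovetailing bound t limits both the stage and the element of M beyond b.
  seen : Pr 2
  seen = some< (sucᶠ v₀) (v₂ <ᴾ v₀ ∧ entered ∘ᴾ (v₁ ∷ˢ v₀ ∷ˢ []ˢ))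

  -- Otherwise all numbers beyond `b` are outside M, so ∁ M meets every late interval (n, n + 1],
  -- against `gaps`.
  seen-total : ∀ xs → ∃[ t ] Holds seen (t ∷ xs)
  seen-total (b ∷ []) = [ id , (λ never → contradiction (cofinite never) (gaps (sucᶠ v₀) (λ _ → ≤-refl) b)) ]′
    (lpo (seen ∘ᴾ (v₀ ∷ˢ const b ∷ˢ []ˢ)))
    where
    cofinite : (∀ t → ¬ Holds seen (t ∷ b ∷ [])) → ∀ n → b ≤ n → ∃[ c ] n < c × c ≤ suc n × c ∉ M
    cofinite never n b≤n = suc n , ≤-refl , ≤-refl , λ 1+n∈M →
      let t , entered≥t = ∈M⇒entered 1+n∈M in
      never (t ⊔ suc n) (suc n , s≤s (m≤n⊔m t (suc n)) , s≤s b≤n , entered≥t _ (m≤m⊔n t (suc n)))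

  -- The inner search fixes a stage at which some element beyond `b` has entered, which makes the
  -- outer condition decidable.
  successor : Pr 2
  successor = v₁ <ᴾ v₀ ∧ entered ∘ᴾ (μ seen seen-total ∘ᶠ (v₁ ∷ˢ []ˢ) ∷ˢ v₀ ∷ˢ []ˢ)

  successor-total : ∀ xs → ∃[ x ] Holds successor (x ∷ xs)
  successor-total (b ∷ []) = Prod.map₂ proj₂ (proj₁ (μ-least seen seen-total (b ∷ [])))

  opaque

    nextᶠ : Fn 1
    nextᶠ = μ successor successor-total

    nextᶠ-spec : ∀ b → b < ⟦ nextᶠ ⟧ (b ∷ []) × ⟦ nextᶠ ⟧ (b ∷ []) ∈ M
    nextᶠ-spec b = Prod.map₂ entered⇒∈M (proj₁ (μ-least successor successor-total (b ∷ [])))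

  r : ℕ → ℕ
  -- The shift by one skips the starting value 0, which may be outside M.
  r i = iterate (λ b → ⟦ nextᶠ ⟧ (b ∷ [])) 0 (suc i)

  rᶠ : Fn 1
  rᶠ = iterateᶠ nextᶠ 0 ∘ᶠ (sucᶠ v₀ ∷ˢ []ˢ)

  r∈M : ∀ i → r i ∈ M
  r∈M i = proj₂ (nextᶠ-spec _)

  r-step : ∀ i → r i < r (suc i)
  r-step i = proj₁ (nextᶠ-spec (r i))

  r-mono-≤ : ∀ {i j} → i ≤ j → r i ≤ r j
  r-mono-≤ = step⇒mono (<⇒≤ ∘ r-step)

  r-mono-< : ∀ {i j} → i < j → r i < r j
  r-mono-< {i} i<j = <-≤-trans (r-step i) (r-mono-≤ i<j)

  r-injective : ∀ {i j} → r i ≡ r j → i ≡ j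
  r-injective {i} {j} eq with <-cmp i j
  ... | tri< i<j _ _ = contradiction eq (<⇒≢ (r-mono-< i<j))
  ... | tri≈ _ i≡j _ = i≡j
  ... | tri> _ _ j<i = contradiction (sym eq) (<⇒≢ (r-mono-< j<i))

  i<r : ∀ i → i < r i
  i<r zero    = ≤-<-trans z≤n (proj₁ (nextᶠ-spec 0))
  i<r (suc i) = ≤-<-trans (i<r i) (r-step i)

  -- Markers and finite blocks

  -- s ∷ m ∷ x, as for covered.
  good : Pr 3
  good = covered ∧ all< v₀ (not (covered ∘ᴾ (v₀ ∷ˢ v₂ ∷ˢ v₃ ∷ˢ []ˢ)))

  -- Minimality leaves at most one good marker for each `m` and `x`, which keeps blocks finite.
  Good : ℕ → ℕ → ℕ → Set
  Good m x s = Least (λ s → Holds covered (s ∷ m ∷ x ∷ [])) s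

  marker : ℕ → ℕ → ℕ → ℕ
  marker m x s = r (triple m x s)

  marker-injective : ∀ {m x s m′ x′ s′} → marker m x s ≡ marker m′ x′ s′ → m ≡ m′ × x ≡ x′ × s ≡ s′
  marker-injective {m} {x} {s} {m′} {x′} {s′} eq =
    let mx≡ , s≡ = pair-injective {pair m x} {s} {pair m′ x′} {s′} (r-injective eq)
        m≡ , x≡  = pair-injective {m} {x} {m′} {x′} mx≡
    in m≡ , x≡ , s≡

  m<marker : ∀ m x s → m < marker m x s
  m<marker m x s = ≤-<-trans (≤-trans (≤-pairˡ m x) (≤-pairˡ (pair m x) s)) (i<r _)

  x<marker : ∀ m x s → x < marker m x s
  x<marker m x s = ≤-<-trans (≤-trans (≤-pairʳ m x) (≤-pairˡ (pair m x) s)) (i<r _)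

  s<marker : ∀ m x s → s < marker m x s
  s<marker m x s = ≤-<-trans (≤-pairʳ (pair m x) s) (i<r _)

  inBlock : Pr 2
  inBlock = v₀ ≡ᴾ v₁ ∨
    -- Both `x` and `s` are smaller than `marker m x s`, so bounding them by y loses no marker.
    some< (sucᶠ v₁) (some< (sucᶠ v₂)
      (v₃ ≡ᴾ rᶠ ∘ᶠ (tripleᶠ v₂ v₁ v₀ ∷ˢ []ˢ) ∧ good ∘ᴾ (v₀ ∷ˢ v₂ ∷ˢ v₁ ∷ˢ []ˢ)))

  inBlock-total : ∀ xs → ∃[ m ] Holds inBlock (m ∷ xs)
  inBlock-total (y ∷ []) = y , inj₁ refl

  opaque

    -- Every y qualifies for its own block. A good marker also qualifies for block `m`, which is
    -- smaller, so the least choice is `m`.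
    blockᶠ : Fn 1
    blockᶠ = μ inBlock inBlock-total

    blockᶠ-least : ∀ y → Least (λ m → Holds inBlock (m ∷ y ∷ [])) (⟦ blockᶠ ⟧ (y ∷ []))
    blockᶠ-least y = μ-least inBlock inBlock-total (y ∷ [])

  block : ℕ → ℕ
  block y = ⟦ blockᶠ ⟧ (y ∷ [])

  block-cases : ∀ {y m} → block y ≡ m → m ≡ y ⊎ (∃[ x ] ∃[ s ] y ≡ marker m x s × Good m x s)
  block-cases {y} refl = Sum.map₂ (λ (x , _ , s , _ , eq , good) → x , s , eq , good) (proj₁ (blockᶠ-least y))

  block≤ : ∀ {y m} → Holds inBlock (m ∷ y ∷ []) → block y ≤ m
  block≤ {y} in-m = ≮⇒≥ λ m<block → proj₂ (blockᶠ-least y) _ m<block in-m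

  block≤id : ∀ y → block y ≤ y
  block≤id y = block≤ {y} {y} (inj₁ refl)

  -- All markers are values of `r` and hence lie in M.
  block-∉M : ∀ {y} → y ∉ M → block y ≡ y
  block-∉M {y} y∉M =
    [ id
    , (λ (x , s , eq , _) → contradiction (subst M (sym eq) (r∈M (triple (block y) x s))) y∉M)
    ]′ (block-cases {y} refl)

  block-marker : ∀ {m x s} → Good m x s → block (marker m x s) ≡ m
  block-marker {m} {x} {s} g =
    [ (λ eq → contradiction (subst (_≤ m) eq block≤m) (<⇒≱ (m<marker m x s)))
    , (λ (x′ , s′ , eq , _) → sym (proj₁ (marker-injective {m} {x} {s} {_} {x′} {s′} eq)))
    ]′ (block-cases {marker m x s} refl)
    where
    block≤m : block (marker m x s) ≤ m
    block≤m = block≤ {marker m x s} {m} (inj₂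
      (x , m<n⇒m<1+n (x<marker m x s) , s , m<n⇒m<1+n (s<marker m x s) , refl , g))

  -- A good stage is at most any covering stage; `lpo` either supplies a covering stage or rules out
  -- good ones.
  good-bounded : ∀ m x → Eventually λ b → ∀ s → Good m x s → marker m x s < b
  good-bounded m x = [ found , (λ never → always λ _ s (cov , _) → contradiction cov (never s)) ]′
    (lpo (covered ∘ᴾ (v₀ ∷ˢ const m ∷ˢ const x ∷ˢ []ˢ)))
    where
    found : (∃[ s ] Holds covered (s ∷ m ∷ x ∷ [])) → Eventually λ b → ∀ s → Good m x s → marker m x s < b
    found (s₀ , cov) = eventually₁
      (λ all s (_ , before) → all s (s≤s (≮⇒≥ λ s₀<s → before s₀ s₀<s cov)))
      (eventually-all< {P = λ s b → marker m x s < b} (suc s₀) λ s _ → suc (marker m x s) , λ _ r<b → r<b)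

  -- A marker in block m is indexed by some x below the next element of ∁ M after m.
  block-bounded : ∀ m → Eventually λ b → ∀ y → block y ≡ m → y < b
  block-bounded m =
    let c , m≤c , c∉M = infinite m in
    eventually₂ (below c m≤c c∉M) (eventually-all< c λ x _ → good-bounded m x) (suc m , λ _ m<b → m<b)
    where
    below : ∀ c → m ≤ c → c ∉ M → ∀ {b} → (∀ x → x < c → ∀ s → Good m x s → marker m x s < b) →
            m < b → ∀ y → block y ≡ m → y < b
    below c m≤c c∉M {b} markers m<b y y∈m =
      [ (λ m≡y → subst (_< b) m≡y m<b)
      , (λ (x , s , eq , good) → subst (_< b) (sym eq)
          (markers x (≰⇒> λ c≤x → c∉M (covered⇒∈M (proj₁ good) m≤c c≤x)) s good))
      ]′ (block-cases y∈m)

  -- The order on ω and its order type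

  _≺_ : Rel ℕ 0ℓ
  x ≺ y = block x < block y ⊎ (block x ≡ block y × y < x)

  ≺-trans : Transitive _≺_
  ≺-trans (inj₁ x<y)         (inj₁ y<z)         = inj₁ (<-trans x<y y<z)
  ≺-trans (inj₁ x<y)         (inj₂ (y≡z , _))   = inj₁ (<-≤-trans x<y (≤-reflexive y≡z))
  ≺-trans (inj₂ (x≡y , _))   (inj₁ y<z)         = inj₁ (≤-<-trans (≤-reflexive x≡y) y<z)
  ≺-trans (inj₂ (x≡y , y<x)) (inj₂ (y≡z , z<y)) = inj₂ (trans x≡y y≡z , <-trans z<y y<x)

  ≺-irrefl : ∀ {x} → ¬ x ≺ x
  ≺-irrefl (inj₁ x<x)       = <-irrefl refl x<x
  ≺-irrefl (inj₂ (_ , x<x)) = <-irrefl refl x<x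

  ≺-total : ∀ x y → x ≺ y ⊎ x ≡ y ⊎ y ≺ x
  ≺-total x y with <-cmp (block x) (block y) | <-cmp x y
  ... | tri< bx<by _ _ | _              = inj₁ (inj₁ bx<by)
  ... | tri> _ _ by<bx | _              = inj₂ (inj₂ (inj₁ by<bx))
  ... | tri≈ _ bx≡by _ | tri< x<y _ _   = inj₂ (inj₂ (inj₂ (sym bx≡by , x<y)))
  ... | tri≈ _ bx≡by _ | tri≈ _ x≡y _   = inj₂ (inj₁ x≡y)
  ... | tri≈ _ bx≡by _ | tri> _ _ y<x   = inj₁ (inj₂ (bx≡by , y<x))

  ≺-cmp : Trichotomous _≡_ _≺_
  ≺-cmp x y = [ (λ x≺y → tri< x≺y (λ { refl → ≺-irrefl x≺y }) (≺-irrefl ∘ ≺-trans x≺y))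
              , [ (λ { refl → tri≈ ≺-irrefl refl ≺-irrefl })
                , (λ y≺x → tri> (≺-irrefl ∘ ≺-trans y≺x) (λ { refl → ≺-irrefl y≺x }) y≺x) ]′
              ]′ (≺-total x y)

  ≺-isStrictTotalOrder : IsStrictTotalOrder _≡_ _≺_
  ≺-isStrictTotalOrder = record
    { isStrictPartialOrder = record
      { isEquivalence = isEquivalence
      ; irrefl        = λ { refl → ≺-irrefl }
      ; trans         = ≺-trans
      ; <-resp-≈      = resp₂ _≺_
      }
    ; compare = ≺-cmp
    }

  -- Predecessors of `x` lie in the finitely many blocks up to that of `x`, and each block is
  -- bounded.
  ≺-initial : ∀ x → ∃[ b ] ∀ y → y ≺ x → y < b
  ≺-initial x =
    let b , bounded = eventually-all< {P = λ m b → ∀ y → block y ≡ m → y < b} (suc (block x)) λ m _ → block-bounded m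
    in b , λ y y≺x → bounded b ≤-refl (block y) (s≤s ([ <⇒≤ , ≤-reflexive ∘ proj₁ ]′ y≺x)) y refl

  ≺-test : Pr 2
  ≺-test = block₀ <ᴾ block₁ ∨ (block₀ ≡ᴾ block₁ ∧ v₁ <ᴾ v₀)
    where
    block₀ block₁ : Fn 2
    block₀ = blockᶠ ∘ᶠ (v₀ ∷ˢ []ˢ)
    block₁ = blockᶠ ∘ᶠ (v₁ ∷ˢ []ˢ)

  L : ComputableLinearOrder
  L = record
    { _<ᴸ_               = _≺_
    ; isStrictTotalOrder = ≺-isStrictTotalOrder
    ; computable         = Holds⇒ComputableRel ≺-test
    }

  L-hasOrderTypeω : HasOrderTypeω L
  L-hasOrderTypeω = rank , rank-isOrderIsomorphism
    where open Rank _≺_ ≺-isStrictTotalOrder ≺-initial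

  -- An element strictly between `[id]` and the class of `f`

  module _ (f : Code 1) (i : ℕ) (halts : ∀ n → i ≤ n → n ∉ M → ¬ ¬ (n ∈ dom f)) where

    -- The first disjunct ends the wait at once for n < i, where `f` may diverge; the value obtained
    -- there is arbitrary.
    waited : Pr 2
    waited = v₁ <ᴾ const i ∨ entered ∨ const 1 ≤ᴾ run f

    waited-total : ∀ xs → ∃[ s ] Holds waited (s ∷ xs)
    waited-total (n ∷ []) = [ id , (λ never → contradiction never (sometimes (n <? i) (∈M? n))) ]′
      (lpo (waited ∘ᴾ (v₀ ∷ˢ const n ∷ˢ []ˢ)))
      where
      sometimes : Dec (n < i) → Dec (n ∈ M) → ¬ (∀ s → ¬ Holds waited (s ∷ n ∷ []))
      sometimes (yes n<i) _         never = never 0 (inj₁ n<i)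
      sometimes (no  _)   (yes n∈M) never =
        let b , e = ∈M⇒entered n∈M in never b (inj₂ (inj₁ (e b ≤-refl)))
      sometimes (no  n≮i) (no  n∉M) never = halts n (≮⇒≥ n≮i) n∉M λ (y , f⇓y) →
        let b , eq = run-complete f⇓y in
        never b (inj₂ (inj₂ (≤-trans (s≤s z≤n) (≤-reflexive (sym (eq b ≤-refl))))))

    valueᶠ : Fn 1
    valueᶠ = run f ∘ᶠ (μ waited waited-total ∷ˢ v₀ ∷ˢ []ˢ)

    value : ℕ → ℕ
    value n = ⟦ valueᶠ ⟧ (n ∷ [])

    -- A bounded run returns `suc` of the output, hence the strict inequality.
    output<value : ∀ {n y} → i ≤ n → n ∉ M → f ⟨ n ⟩⇓ y → y < value n
    output<value {n} i≤n n∉M f⇓y =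
      [ (λ n<i → contradiction i≤n (<⇒≱ n<i))
      , [ (λ e → contradiction (entered⇒∈M e) n∉M)
        , (λ 1≤v → let 1+pred = suc-pred _ ⦃ >-nonZero 1≤v ⦄ in
            ≤-reflexive (trans (cong suc (⇓-deterministic f⇓y (run-sound f _ (n ∷ []) (sym 1+pred)))) 1+pred)) ]′
      ]′ (proj₁ (μ-least waited waited-total (n ∷ [])))

    Gᶠ : Fn 1
    Gᶠ = majorantᶠ valueᶠ

    dominated : Eventually λ n → n ∉ M → ∃[ s ] Holds covered (s ∷ suc n ∷ majorant value n ∷ [])
    dominated = sparse Gᶠ (k<majorant value) (majorant-mono value)

    j : ℕ
    j = proj₁ dominated

    -- For n outside M with n at least `j` only the third disjunct can hold, so the least stage is
    -- the least covering stage, as `Good` demands.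
    delayed : Pr 2
    delayed = v₁ <ᴾ const j ∨ entered ∨ covered ∘ᴾ (v₀ ∷ˢ sucᶠ v₁ ∷ˢ Gᶠ ∘ᶠ (v₁ ∷ˢ []ˢ) ∷ˢ []ˢ)

    delayed-total : ∀ xs → ∃[ s ] Holds delayed (s ∷ xs)
    delayed-total (n ∷ []) = total (n <? j) (∈M? n)
      where
      total : Dec (n < j) → Dec (n ∈ M) → ∃[ s ] Holds delayed (s ∷ n ∷ [])
      total (yes n<j) _         = 0 , inj₁ n<j
      total (no  _)   (yes n∈M) = let b , e = ∈M⇒entered n∈M in b , inj₂ (inj₁ (e b ≤-refl))
      total (no  n≮j) (no  n∉M) = let s , cov = proj₂ dominated n (≮⇒≥ n≮j) n∉M in s , inj₂ (inj₂ cov)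

    stageᶠ : Fn 1
    stageᶠ = μ delayed delayed-total

    stage-good : ∀ n → j ≤ n → n ∉ M → Good (suc n) (majorant value n) (⟦ stageᶠ ⟧ (n ∷ []))
    stage-good n j≤n n∉M =
      let stop , before = μ-least delayed delayed-total (n ∷ []) in
      [ (λ n<j → contradiction j≤n (<⇒≱ n<j))
      , [ (λ e → contradiction (entered⇒∈M e) n∉M) , id ]′
      ]′ stop , λ s s<stage cov → before s s<stage (inj₂ (inj₂ cov))

    opaque

      insertedᶠ : Fn 1
      insertedᶠ = rᶠ ∘ᶠ (tripleᶠ (sucᶠ v₀) Gᶠ stageᶠ ∷ˢ []ˢ)

      ⟦insertedᶠ⟧ : ∀ n → ⟦ insertedᶠ ⟧ (n ∷ []) ≡ marker (suc n) (majorant value n) (⟦ stageᶠ ⟧ (n ∷ []))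
      ⟦insertedᶠ⟧ n = refl

    inserted : ℕ → ℕ
    inserted n = ⟦ insertedᶠ ⟧ (n ∷ [])

    block-inserted : ∀ n → j ≤ n → n ∉ M → block (inserted n) ≡ suc n
    block-inserted n j≤n n∉M = trans (cong block (⟦insertedᶠ⟧ n))
      (block-marker {suc n} {majorant value n} (stage-good n j≤n n∉M))

    output<inserted : ∀ {n y} → i ≤ n → n ∉ M → f ⟨ n ⟩⇓ y → y < inserted n
    output<inserted {n} {y} i≤n n∉M f⇓y = subst (y <_) (sym (⟦insertedᶠ⟧ n))
      (<-trans (<-≤-trans (output<value i≤n n∉M f⇓y) (f≤majorant value n))
        (x<marker (suc n) (majorant value n) (⟦ stageᶠ ⟧ (n ∷ []))))

    ≺-inserted : ∀ n → j ≤ n → n ∉ M → n ≺ inserted n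
    ≺-inserted n j≤n n∉M = inj₁ (subst₂ _<_ (sym (block-∉M n∉M)) (sym (block-inserted n j≤n n∉M)) ≤-refl)

    inserted-≺ : ∀ {n y} → i ≤ n → j ≤ n → n ∉ M → f ⟨ n ⟩⇓ y → n ≺ y → inserted n ≺ y
    inserted-≺ {n} {y} i≤n j≤n n∉M f⇓y (inj₂ (bn≡by , y<n)) =
      -- Here `y` would be in block `n` with y < n, but no number is below its block.
      contradiction (≤-trans (≤-reflexive (trans (sym (block-∉M n∉M)) bn≡by)) (block≤id y)) (<⇒≱ y<n)
    inserted-≺ {n} {y} i≤n j≤n n∉M f⇓y (inj₁ bn<by) =
      next-block (m≤n⇒m<n∨m≡n n<by)
      where
      n<by : n < block y
      n<by = subst (_< block y) (block-∉M n∉M) bn<by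

      eq : block (inserted n) ≡ suc n
      eq = block-inserted n j≤n n∉M

      next-block : suc n < block y ⊎ suc n ≡ block y → inserted n ≺ y
      next-block (inj₁ 1+n<by) = inj₁ (≤-<-trans (≤-reflexive eq) 1+n<by)
      -- Within block n + 1 the order is reversed, so the larger marker comes first.
      next-block (inj₂ 1+n≡by) = inj₂ (trans eq 1+n≡by , output<inserted i≤n n∉M f⇓y)

  [id]-noImmediateSuccessor : ∀ {C} → C ≐ ∁ M → ¬ HasImmediateSuccessor (Π C L) ([id] C)
  [id]-noImmediateSuccessor {C} (C⊆∁M , ∁M⊆C) ((f , i , undefined) , (k , id<f) , gap) =
    -- `ψ` is total, hence the bound 0. The last bound joins `i` for the domain of `f`, `j₀` for
    -- good markers and `k` for `[id]` below `f`.
    gap ((code ψ , 0 , λ n _ (_ , n∉dom) → n∉dom (_ , code⇓ ψ (n ∷ []))) , (j₀ , id<ψ) , (i ⊔ (j₀ ⊔ k) , ψ<f))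
    where
    -- `⊆*` only refutes divergence, hence the double negation.
    halts : ∀ n → i ≤ n → n ∉ M → ¬ ¬ (n ∈ dom f)
    halts n i≤n n∉M n∉dom = undefined n i≤n (∁M⊆C n∉M , n∉dom)

    ψ : Fn 1
    ψ = insertedᶠ f i halts

    j₀ : ℕ
    j₀ = j f i halts

    id<ψ : ∀ n → j₀ ≤ n → ¬ (n ∈ C × ¬ (∃[ y ] ∃[ z ] proj zero ⟨ n ⟩⇓ y × code ψ ⟨ n ⟩⇓ z × y ≺ z))
    id<ψ n j₀≤n (n∈C , ¬<) =
      ¬< (n , _ , proj⇓ zero , code⇓ ψ (n ∷ []) , ≺-inserted f i halts n j₀≤n (C⊆∁M n∈C))

    ψ<f : ∀ n → i ⊔ (j₀ ⊔ k) ≤ n → ¬ (n ∈ C × ¬ (∃[ y ] ∃[ z ] code ψ ⟨ n ⟩⇓ y × f ⟨ n ⟩⇓ z × y ≺ z))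
    ψ<f n ≤n (n∈C , ¬<) =
      let i≤n    = m⊔n≤o⇒m≤o i (j₀ ⊔ k) ≤n
          j₀⊔k≤n = m⊔n≤o⇒n≤o i (j₀ ⊔ k) ≤n
      in id<f n (m⊔n≤o⇒n≤o j₀ k j₀⊔k≤n) (n∈C , λ (x , y , id⇓x , f⇓y , x≺y) →
        ¬< (_ , y , code⇓ ψ (n ∷ []) , f⇓y ,
            inserted-≺ f i halts i≤n (m⊔n≤o⇒m≤o j₀ k j₀⊔k≤n) (C⊆∁M n∈C) f⇓y
              (subst (_≺ y) (⇓-deterministic id⇓x (proj⇓ zero)) x≺y)))

-- The order `L` and its cohesive power over `C`

theorem12 :
    (C : Pred ℕ 0ℓ) → CoMaximal C →
    Σ ComputableLinearOrder λ L →
      HasOrderTypeω L ×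
      ¬ HasImmediateSuccessor (Π C L) ([id] C) ×
      ¬ (Π C L ≅ 𝐍+𝐐×𝐙)
theorem12 C (M , (M-ce , ∁M-cohesive) , C≐∁M) =
  L , L-hasOrderTypeω , noSuccessor , λ iso →
    noSuccessor (≅𝐍+𝐐×𝐙⇒hasImmediateSuccessor (Π C L) (λ {φ} → Π-refl φ) iso ([id] C))
  where
  open Construction M M-ce ∁M-cohesive

  noSuccessor : ¬ HasImmediateSuccessor (Π C L) ([id] C)
  noSuccessor = [id]-noImmediateSuccessor C≐∁M

  Π-refl : (φ : Dom C) → RawRelation._≈_ (Π C L) φ φ
  Π-refl (φ , i , halts) = i , λ n i≤n (n∈C , ¬≈) → halts n i≤n (n∈C , λ (y , φ⇓y) → ¬≈ (y , φ⇓y , φ⇓y))
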